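{- Let $n\ge 1$, $r\ge 0$, and let $J\subseteq\Delta^r_n$ be a nonempty subset. Then $J$ is M-convex if and only if its characteristic function $\chi_J\colon\Delta^r_n\to\mathbb K$ satisfies the Plücker relations \[ \sum_{k=0}^s \chi_J\big(\alpha+\epsilon_{i_0}+\dots+\widehat{\epsilon_{i_k}}+\dots+\epsilon_{i_s}\big)\cdot\chi_J\big(\alpha+\epsilon_{i_k}+\epsilon_{j_2}+\dots+\epsilon_{j_s}\big)\ \in\ N_{\mathbb K} \] for every $s\in\{2,\dots,r\}$, every $\alpha\in\Delta^{r-s}_n$ with $\delta^-_J\le\alpha$, and all $i_0,\dots,i_s,j_2,\dots,j_s\in[n]$ such that $\alpha+\epsilon_{i_0}+\dots+\epsilon_{i_s}+\epsilon_{j_2}+\dots+\epsilon_{j_s}\le\delta^+_J$. (Here the hat means the term is omitted.)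
   Context: $\Delta^r_n=\{\alpha\in\mathbb N^n:\alpha_1+\dots+\alpha_n=r\}$; $\epsilon_i$ is the $i$-th standard basis vector; $\le$ is the componentwise partial order on $\mathbb Z^n$. A nonempty $J\subseteq\Delta^r_n$ is M-convex if for all $\alpha,\beta\in J$ and every $i\in[n]$ with $\alpha_i<\beta_i$ there is $j\in[n]$ with $\alpha_j>\beta_j$ such that both $\alpha+\epsilon_i-\epsilon_j$ and $\beta-\epsilon_i+\epsilon_j$ lie in $J$. For finite $J$, $\delta^-_J=\inf J$ and $\delta^+_J=\sup J$ are the vectors with $\delta^-_{J,i}=\min\{\alpha_i:\alpha\in J\}$ and $\delta^+_{J,i}=\max\{\alpha_i:\alpha\in J\}$. The Krasner hyperfield is $\mathbb K=\{0,1\}$; a formal sum of elements of $\mathbb K$ lies in its null set $N_{\mathbb K}$ if and only if the number of summands equal to $1$ is not exactly one. $\chi_J(\alpha)=1$ if $\alpha\in J$ and $0$ otherwise. -}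

module Defs where

open import Data.Bool.Base using (if_then_else_)
open import Data.Fin.Base using (Fin)
open import Data.List.Base using (List; []; _∷_; concatMap; filter; upTo)
import Data.List.Base as List
open import Data.List.Extrema.Nat using (min; max; min≤xs; xs≤max; argmin-sel; argmax-sel)
open import Data.List.Membership.Propositional using (lose) renaming (_∈_ to _∈ₗ_)
open import Data.List.Membership.Propositional.Properties
  using (∈-map⁺; ∈-map⁻; ∈-concatMap⁺; ∈-upTo⁺; ∈-filter⁺; ∈-filter⁻)
import Data.List.Relation.Unary.All as All
open import Data.List.Relation.Unary.Any using (here)
open import Data.Nat.Base using (ℕ; zero; suc; _+_; _∸_; _≤_; _<_; _>_; s≤s)
open import Data.Nat.Properties using (m≤m+n; m+n∸m≡n)
open import Data.Product.Base using (∃-syntax; _×_; _,_; proj₁; proj₂)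
open import Data.Sum.Base using (inj₁; inj₂)
open import Data.Vec.Base
  using (Vec; []; _∷_; lookup; tabulate; replicate; zipWith; _[_]≔_; removeAt; foldr′; map; sum; count)
open import Data.Vec.Properties using (lookup∘tabulate)
open import Data.Vec.Relation.Binary.Pointwise.Inductive using (Pointwise)
open import Function.Base using (id)
open import Level using (Level)
open import Relation.Binary.Definitions using (DecidableEquality)
open import Relation.Binary.PropositionalEquality
  using (_≡_; _≢_; refl; sym; trans; subst)
open import Relation.Nullary using (yes; no; ⌊_⌋)
open import Relation.Unary using (Pred; Decidable; Satisfiable; _∈_; _⊆_)

private
  variable
    ℓ : Level
    n m : ℕ

infixl 7 _·_
infixl 6 _⊕_ _⊖_
infix  4 _≤ᵛ_ _≟_

ε : Fin n → Vec ℕ n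
ε i = replicate _ 0 [ i ]≔ 1

_⊕_ : Vec ℕ n → Vec ℕ n → Vec ℕ n
_⊕_ = zipWith _+_

-- Truncated at 0, unlike subtraction in ℤⁿ.
_⊖_ : Vec ℕ n → Vec ℕ n → Vec ℕ n
_⊖_ = zipWith _∸_

_≤ᵛ_ : Vec ℕ n → Vec ℕ n → Set
_≤ᵛ_ = Pointwise _≤_

-- ε-sum (i₁ ∷ … ∷ iₘ ∷ []) = ε i₁ ⊕ … ⊕ ε iₘ, with repeated indices allowed.
ε-sum : Vec (Fin n) m → Vec ℕ n
ε-sum is = foldr′ _⊕_ (replicate _ 0) (map ε is)

Δ : (n r : ℕ) → Pred (Vec ℕ n) _
Δ n r α = sum α ≡ r

-- Neither _⊖_ truncates: it is applied only where
-- lookup α j > lookup β j ≥ 0 and lookup β i > lookup α i ≥ 0.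
MConvex : Pred (Vec ℕ n) ℓ → Set ℓ
MConvex {n = n} J = ∀ {α β : Vec ℕ n} → α ∈ J → β ∈ J →
  ∀ (i : Fin n) → lookup α i < lookup β i →
  ∃[ j ] (lookup α j > lookup β j
          × (α ⊕ ε i ⊖ ε j) ∈ J
          × (β ⊖ ε i ⊕ ε j) ∈ J)

Δ-list : (n r : ℕ) → List (Vec ℕ n)
Δ-list zero    zero    = [] ∷ []
Δ-list zero    (suc _) = []
Δ-list (suc n) r       = concatMap (λ k → List.map (k ∷_) (Δ-list n (r ∸ k))) (upTo (suc r))

-- For J ⊆ Δ n r, this lists all of J.
elements : (r : ℕ) {J : Pred (Vec ℕ n) ℓ} → Decidable J → List (Vec ℕ n)
elements {n = n} r J? = filter J? (Δ-list n r)

-- The first argument of min and max is an additional candidate; taking it from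
-- an element of J leaves the extremum over J unchanged.
δ⁻ δ⁺ : (r : ℕ) {J : Pred (Vec ℕ n) ℓ} → Decidable J → Satisfiable J → Vec ℕ n
δ⁻ r J? (α₀ , _) = tabulate λ i → min (lookup α₀ i) (List.map (λ α → lookup α i) (elements r J?))
δ⁺ r J? (α₀ , _) = tabulate λ i → max (lookup α₀ i) (List.map (λ α → lookup α i) (elements r J?))

Δ-list-complete : ∀ (α : Vec ℕ n) {r} → α ∈ Δ n r → α ∈ₗ Δ-list n r
Δ-list-complete []      refl = here refl
Δ-list-complete {n = suc n} (a ∷ α) refl =
  ∈-concatMap⁺ (λ k → List.map (k ∷_) (Δ-list n (a + sum α ∸ k)))
    (lose (∈-upTo⁺ (s≤s (m≤m+n a (sum α))))
          (∈-map⁺ (a ∷_) (Δ-list-complete α (sym (m+n∸m≡n a (sum α))))))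

module _ {r : ℕ} {J : Pred (Vec ℕ n) ℓ} (J? : Decidable J) (ne : Satisfiable J) where

  δ⁻-lower : J ⊆ Δ n r → ∀ i {α} → α ∈ J → lookup (δ⁻ r J? ne) i ≤ lookup α i
  δ⁻-lower J⊆Δ i {α} α∈J = subst (_≤ lookup α i) (sym (lookup∘tabulate _ i))
    (All.lookup (min≤xs (lookup (proj₁ ne) i) _)
      (∈-map⁺ (λ α → lookup α i) (∈-filter⁺ J? (Δ-list-complete α (J⊆Δ α∈J)) α∈J)))

  δ⁺-upper : J ⊆ Δ n r → ∀ i {α} → α ∈ J → lookup α i ≤ lookup (δ⁺ r J? ne) i
  δ⁺-upper J⊆Δ i {α} α∈J = subst (lookup α i ≤_) (sym (lookup∘tabulate _ i))
    (All.lookup (xs≤max (lookup (proj₁ ne) i) _)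
      (∈-map⁺ (λ α → lookup α i) (∈-filter⁺ J? (Δ-list-complete α (J⊆Δ α∈J)) α∈J)))

  δ⁻-attained : ∀ i → ∃[ α ] (α ∈ J × lookup (δ⁻ r J? ne) i ≡ lookup α i)
  δ⁻-attained i with argmin-sel id (lookup (proj₁ ne) i) (List.map (λ α → lookup α i) (elements r J?))
  ... | inj₁ eq = proj₁ ne , proj₂ ne , trans (lookup∘tabulate _ i) eq
  ... | inj₂ x∈ with ∈-map⁻ (λ α → lookup α i) x∈
  ...   | α , α∈ , eq = α , proj₂ (∈-filter⁻ J? {xs = Δ-list n r} α∈) , trans (lookup∘tabulate _ i) eq

  δ⁺-attained : ∀ i → ∃[ α ] (α ∈ J × lookup (δ⁺ r J? ne) i ≡ lookup α i)
  δ⁺-attained i with argmax-sel id (lookup (proj₁ ne) i) (List.map (λ α → lookup α i) (elements r J?))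
  ... | inj₁ eq = proj₁ ne , proj₂ ne , trans (lookup∘tabulate _ i) eq
  ... | inj₂ x∈ with ∈-map⁻ (λ α → lookup α i) x∈
  ...   | α , α∈ , eq = α , proj₂ (∈-filter⁻ J? {xs = Δ-list n r} α∈) , trans (lookup∘tabulate _ i) eq

data 𝕂 : Set where
  𝟘 𝟙 : 𝕂

_·_ : 𝕂 → 𝕂 → 𝕂
𝟘 · _ = 𝟘
𝟙 · y = y

_≟_ : DecidableEquality 𝕂
𝟘 ≟ 𝟘 = yes refl
𝟘 ≟ 𝟙 = no λ ()
𝟙 ≟ 𝟘 = no λ ()
𝟙 ≟ 𝟙 = yes refl

-- The formal sum x₁ + … + xₘ is the vector of its summands.
N𝕂 : Pred (Vec 𝕂 m) _
N𝕂 xs = count (_≟ 𝟙) xs ≢ 1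

-- The extension by 𝟘 to ℕⁿ of the characteristic function of J ⊆ Δ n r.
χ : {J : Pred (Vec ℕ n) ℓ} → Decidable J → Vec ℕ n → 𝕂
χ J? α = if ⌊ J? α ⌋ then 𝟙 else 𝟘

-- i = (i₀ , … , iₛ) and j = (j₂ , … , jₛ).  Both arguments of χ have degree
-- (r ∸ s) + s = r, so χ is evaluated only on Δ n r.
PlückerRelations : (r : ℕ) {J : Pred (Vec ℕ n) ℓ} → Decidable J → Satisfiable J → Set
PlückerRelations {n = n} r J? ne =
  ∀ (s : ℕ) → 2 ≤ s → s ≤ r →
  ∀ (α : Vec ℕ n) → α ∈ Δ n (r ∸ s) → δ⁻ r J? ne ≤ᵛ α →
  ∀ (i : Vec (Fin n) (suc s)) (j : Vec (Fin n) (s ∸ 1)) →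
  α ⊕ ε-sum i ⊕ ε-sum j ≤ᵛ δ⁺ r J? ne →
  tabulate (λ (k : Fin (suc s)) →
    χ J? (α ⊕ ε-sum (removeAt i k)) · χ J? (α ⊕ ε (lookup i k) ⊕ ε-sum j))
  ∈ N𝕂

{-# OPTIONS --safe #-}
-- Only-if: if the k-th summand is 1 then its factors are β = α + Σ_{l ≠ k} ε_{i_l}
-- and γ = α + ε_{i_k} + Σ ε_j in J.  Exchanging i_k between β and γ, or doing
-- nothing when i_k already repeats in i, yields an index i_l with l ≠ k whose
-- summand is 1 as well.
-- If: for α, β ∈ J with αᵢ < βᵢ, apply the relation based at the componentwise
-- minimum of α and β, with i₀ = i, i₁ + … + iₛ = α − (α ∧ β) and
-- j₂ + … + jₛ = β − (α ∧ β) − εᵢ.  Its upper bound is α ∨ β ≤ δ⁺, its 0-th summand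
-- is χ(α) χ(β) = 1, and any other nonzero summand is an exchange.  For s = 1 there
-- is no relation, but there the exchange merely swaps α and β.
module Submission where

open import Defs
open import Algebra.Bundles using (CommutativeSemigroup)
import Algebra.Properties.CommutativeSemigroup as CommutativeSemigroupProperties
open import Data.Fin.Base using (Fin; zero; suc; punchIn)
open import Data.Fin.Properties using (punchInᵢ≢i; punchOut-punchIn) renaming (_≟_ to _≟ᶠ_)
open import Data.Nat.Base using (ℕ; zero; suc; _+_; _∸_; _⊓_; _≤_; _<_; _≥_; z≤n; s≤s; z<s)
open import Data.Nat.Properties hiding (_≟_)
open import Data.Product.Base using (∃; ∃-syntax; _×_; _,_; proj₁; proj₂)
open import Data.Vec.Base
  using (Vec; []; _∷_; lookup; tabulate; replicate; zipWith; removeAt; map; sum; count)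
open import Data.Vec.Properties
open import Data.Vec.Relation.Binary.Pointwise.Extensional using (ext; extensional⇒inductive)
open import Function.Base using (_∘_)
open import Function.Bundles using (_⇔_; mk⇔)
open import Level using (Level)
open import Relation.Binary.PropositionalEquality
open import Relation.Nullary using (¬_; yes; no; contradiction)
open import Relation.Unary using (Pred; Decidable; Satisfiable; _∈_; _⊆_)

private
  variable
    a p ℓ : Level
    A : Set a
    m n : ℕ

-- Arithmetic of exponent vectors and their degrees

⊕-assoc : (x y z : Vec ℕ n) → x ⊕ y ⊕ z ≡ x ⊕ (y ⊕ z)
⊕-assoc = zipWith-assoc +-assoc

⊕-comm : (x y : Vec ℕ n) → x ⊕ y ≡ y ⊕ x
⊕-comm = zipWith-comm +-comm

⊕-identityˡ : (x : Vec ℕ n) → replicate n 0 ⊕ x ≡ x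
⊕-identityˡ = zipWith-identityˡ +-identityˡ

⊕-commutativeSemigroup : ℕ → CommutativeSemigroup _ _
⊕-commutativeSemigroup n = record
  { _∙_ = _⊕_ {n}
  ; isCommutativeSemigroup = record
    { isSemigroup = record
      { isMagma = record { isEquivalence = isEquivalence ; ∙-cong = cong₂ _⊕_ }
      ; assoc = ⊕-assoc
      }
    ; comm = ⊕-comm
    }
  }

module ⊕ {n} = CommutativeSemigroupProperties (⊕-commutativeSemigroup n)

x⊕y⊖y≡x : (x y : Vec ℕ n) → x ⊕ y ⊖ y ≡ x
x⊕y⊖y≡x []      []      = refl
x⊕y⊖y≡x (a ∷ x) (b ∷ y) = cong₂ _∷_ (m+n∸n≡m a b) (x⊕y⊖y≡x x y)

lookup-⊕ : ∀ i (x y : Vec ℕ n) → lookup (x ⊕ y) i ≡ lookup x i + lookup y i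
lookup-⊕ = lookup-zipWith _+_

sum-⊕ : (x y : Vec ℕ n) → sum (x ⊕ y) ≡ sum x + sum y
sum-⊕ []      []      = refl
sum-⊕ (a ∷ x) (b ∷ y) = begin
  a + b + sum (x ⊕ y)      ≡⟨ cong (a + b +_) (sum-⊕ x y) ⟩
  a + b + (sum x + sum y)  ≡⟨ +-interchange a b (sum x) (sum y) ⟩
  a + sum x + (b + sum y)  ∎
  where
  open ≡-Reasoning
  +-interchange = CommutativeSemigroupProperties.interchange +-commutativeSemigroup

sum-replicate-0 : ∀ n → sum (replicate n 0) ≡ 0
sum-replicate-0 zero    = refl
sum-replicate-0 (suc n) = sum-replicate-0 n

sum-ε : (i : Fin n) → sum (ε i) ≡ 1
sum-ε {suc n} zero    = cong suc (sum-replicate-0 n)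
sum-ε         (suc i) = sum-ε i

-- Componentwise minimum and truncated difference

_∧_ : Vec ℕ n → Vec ℕ n → Vec ℕ n
_∧_ = zipWith _⊓_

∧-comm : (x y : Vec ℕ n) → x ∧ y ≡ y ∧ x
∧-comm = zipWith-comm ⊓-comm

-- Truncation is what makes this work: `y ⊖ x` equals y - (x ∧ y) in every coordinate.
x∧y⊕[y⊖x]≡y : (x y : Vec ℕ n) → (x ∧ y) ⊕ (y ⊖ x) ≡ y
x∧y⊕[y⊖x]≡y []      []      = refl
x∧y⊕[y⊖x]≡y (a ∷ x) (b ∷ y) = cong₂ _∷_ (m⊓n+n∸m≡n a b) (x∧y⊕[y⊖x]≡y x y)

-- The left side of the conclusion is the maximum of m and n; this serves to bound α ∨ β by `δ⁺`.
m≤o∧n≤o⇒m+[n∸m]≤o : ∀ {m n o} → m ≤ o → n ≤ o → m + (n ∸ m) ≤ o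
m≤o∧n≤o⇒m+[n∸m]≤o {zero}              _         n≤o       = n≤o
m≤o∧n≤o⇒m+[n∸m]≤o {suc m} {zero}      m≤o       _         rewrite +-identityʳ m = m≤o
m≤o∧n≤o⇒m+[n∸m]≤o {suc m} {suc n} (s≤s m≤o) (s≤s n≤o) = s≤s (m≤o∧n≤o⇒m+[n∸m]≤o m≤o n≤o)

-- Unit vectors and their sums

0<lookup⇒≡ε⊕ : ∀ (i : Fin n) {x} → 0 < lookup x i → ∃[ y ] x ≡ ε i ⊕ y
0<lookup⇒≡ε⊕ zero    {suc a ∷ x} _ = a ∷ x , cong (suc a ∷_) (sym (⊕-identityˡ x))
0<lookup⇒≡ε⊕ (suc i) {a ∷ x}     0<xᵢ with 0<lookup⇒≡ε⊕ i {x} 0<xᵢ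
... | y , x≡ε⊕y = a ∷ y , cong (a ∷_) x≡ε⊕y

0<lookup-ε⇒≡ : ∀ (i k : Fin n) → 0 < lookup (ε i) k → i ≡ k
0<lookup-ε⇒≡ i k 0<εᵢₖ with i ≟ᶠ k
... | yes i≡k = i≡k
... | no  i≢k = contradiction
  (sym (trans (lookup∘update′ (i≢k ∘ sym) (replicate _ 0) 1) (lookup-replicate k 0))) (<⇒≢ 0<εᵢₖ)

0<lookup-ε : (i : Fin n) → 0 < lookup (ε i) i
0<lookup-ε i rewrite lookup∘update i (replicate _ 0) 1 = z<s

0<lookup-ε-sum⇒∃ : ∀ (is : Vec (Fin n) m) k → 0 < lookup (ε-sum is) k → ∃[ l ] lookup is l ≡ k
0<lookup-ε-sum⇒∃ []       k 0<Σₖ = contradiction (sym (lookup-replicate k 0)) (<⇒≢ 0<Σₖ)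
0<lookup-ε-sum⇒∃ (i ∷ is) k 0<Σₖ with lookup (ε i) k in eq
... | suc _ = zero , 0<lookup-ε⇒≡ i k (subst (0 <_) (sym eq) z<s)
... | zero with 0<lookup-ε-sum⇒∃ is k
                  (subst (0 <_) (trans (lookup-⊕ k (ε i) (ε-sum is)) (cong (_+ _) eq)) 0<Σₖ)
...   | l , isₗ≡k = suc l , isₗ≡k

0<lookup-ε-sum : ∀ (is : Vec (Fin n) m) l → 0 < lookup (ε-sum is) (lookup is l)
0<lookup-ε-sum (i ∷ is) zero    rewrite lookup-⊕ i (ε i) (ε-sum is) =
  <-≤-trans (0<lookup-ε i) (m≤m+n _ _)
0<lookup-ε-sum (i ∷ is) (suc l) rewrite lookup-⊕ (lookup is l) (ε i) (ε-sum is) =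
  <-≤-trans (0<lookup-ε-sum is l) (m≤n+m _ _)

ε-sum-map-suc : (is : Vec (Fin n) m) → ε-sum (map suc is) ≡ 0 ∷ ε-sum is
ε-sum-map-suc []       = refl
ε-sum-map-suc (i ∷ is) = cong (ε (suc i) ⊕_) (ε-sum-map-suc is)

-- Each unit of the head entry contributes one index `zero`; once the head is exhausted, the indices
-- of the tail are shifted by `suc`.
ε-sum-surjective : (x : Vec ℕ n) → ∃ λ (is : Vec (Fin n) (sum x)) → ε-sum is ≡ x
ε-sum-surjective []           = [] , refl
ε-sum-surjective (zero ∷ x)   with ε-sum-surjective x
... | is , Σ≡x = map suc is , trans (ε-sum-map-suc is) (cong (0 ∷_) Σ≡x)
ε-sum-surjective (suc a ∷ x)  with ε-sum-surjective (a ∷ x)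
... | is , Σ≡x = zero ∷ is , trans (cong (ε zero ⊕_) Σ≡x) (cong (suc a ∷_) (⊕-identityˡ x))

ε-sum-removeAt : ∀ (is : Vec (Fin n) (suc m)) k → ε-sum (removeAt is k) ⊕ ε (lookup is k) ≡ ε-sum is
ε-sum-removeAt (i ∷ is)        zero    = ⊕-comm (ε-sum is) (ε i)
ε-sum-removeAt (i ∷ is@(_ ∷ _)) (suc k) = trans
  (⊕-assoc (ε i) (ε-sum (removeAt is k)) (ε (lookup is k)))
  (cong (ε i ⊕_) (ε-sum-removeAt is k))

lookup-removeAt : ∀ (xs : Vec A (suc n)) k l → lookup (removeAt xs k) l ≡ lookup xs (punchIn k l)
lookup-removeAt xs k l = trans
  (cong (lookup (removeAt xs k)) (sym (punchOut-punchIn k)))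
  (removeAt-punchOut xs (punchInᵢ≢i k l ∘ sym))

-- The two factors of the l-th Plücker term arise from those of the k-th one by
-- an exchange of i_k for i_l.
exchangeˡ : ∀ α (i : Vec (Fin n) (suc m)) k l →
  α ⊕ ε-sum (removeAt i k) ⊕ ε (lookup i k) ⊖ ε (lookup i l) ≡ α ⊕ ε-sum (removeAt i l)
exchangeˡ α i k l = begin
  α ⊕ ε-sum (removeAt i k) ⊕ ε (lookup i k) ⊖ ε (lookup i l)
    ≡⟨ cong (_⊖ ε (lookup i l)) (trans (total k) (sym (total l))) ⟩
  α ⊕ ε-sum (removeAt i l) ⊕ ε (lookup i l) ⊖ ε (lookup i l)
    ≡⟨ x⊕y⊖y≡x _ _ ⟩
  α ⊕ ε-sum (removeAt i l) ∎
  where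
  open ≡-Reasoning
  total : ∀ k → α ⊕ ε-sum (removeAt i k) ⊕ ε (lookup i k) ≡ α ⊕ ε-sum i
  total k = trans (⊕-assoc α _ _) (cong (α ⊕_) (ε-sum-removeAt i k))

exchangeʳ : ∀ (α x y z : Vec ℕ n) → α ⊕ x ⊕ z ⊖ x ⊕ y ≡ α ⊕ y ⊕ z
exchangeʳ α x y z = begin
  α ⊕ x ⊕ z ⊖ x ⊕ y  ≡⟨ cong (λ w → w ⊖ x ⊕ y) (⊕.xy∙z≈xz∙y α x z) ⟩
  α ⊕ z ⊕ x ⊖ x ⊕ y  ≡⟨ cong (_⊕ y) (x⊕y⊖y≡x (α ⊕ z) x) ⟩
  α ⊕ z ⊕ y          ≡⟨ ⊕.xy∙z≈xz∙y α z y ⟩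
  α ⊕ y ⊕ z          ∎
  where open ≡-Reasoning

-- Null sums over the Krasner hyperfield: counting nonzero summands

module _ {P : Pred A p} (P? : Decidable P) where

  count≢0⇒∃ : (f : Fin n → A) → count P? (tabulate f) ≢ 0 → ∃[ k ] P (f k)
  count≢0⇒∃ {zero}  f c≢0 = contradiction refl c≢0
  count≢0⇒∃ {suc n} f c≢0 with P? (f zero)
  ... | yes p = zero , p
  ... | no  _ with count≢0⇒∃ (f ∘ suc) c≢0
  ...   | k , p = suc k , p

  count≡0⇒∄ : (f : Fin n → A) → count P? (tabulate f) ≡ 0 → ∀ k → ¬ P (f k)
  count≡0⇒∄ {suc n} f c≡0 k pk with P? (f zero) | k
  ... | no ¬p | zero  = ¬p pk
  ... | no _  | suc l = count≡0⇒∄ (f ∘ suc) c≡0 l pk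

  -- A sum outside the null set has a unique nonzero summand, which a second one would contradict.
  count≡1⇒∃! : (f : Fin n → A) → count P? (tabulate f) ≡ 1 →
    ∃[ k ] (P (f k) × (∀ l → P (f l) → l ≡ k))
  count≡1⇒∃! {suc n} f c≡1 with P? (f zero)
  ... | yes p = zero , p , λ where
    zero    _ → refl
    (suc l) q → contradiction q (count≡0⇒∄ (f ∘ suc) (suc-injective c≡1) l)
  ... | no ¬p with count≡1⇒∃! (f ∘ suc) c≡1
  ...   | k , p , unique = suc k , p , λ where
    zero    q → contradiction q ¬p
    (suc l) q → cong suc (unique l q)

  P0∧count≢1⇒∃ : (f : Fin (suc n) → A) → P (f zero) → count P? (tabulate f) ≢ 1 →
    ∃[ l ] P (f (suc l))
  P0∧count≢1⇒∃ f p c≢1 with P? (f zero)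
  ... | yes _ = count≢0⇒∃ (f ∘ suc) (c≢1 ∘ cong suc)
  ... | no ¬p = contradiction p ¬p

module _ {J : Pred (Vec ℕ n) ℓ} (J? : Decidable J) where

  χ·χ≡𝟙⁺ : ∀ {α β} → α ∈ J → β ∈ J → χ J? α · χ J? β ≡ 𝟙
  χ·χ≡𝟙⁺ {α} {β} α∈J β∈J with J? α | J? β
  ... | yes _   | yes _   = refl
  ... | yes _   | no  β∉J = contradiction β∈J β∉J
  ... | no  α∉J | _       = contradiction α∈J α∉J

  χ·χ≡𝟙⁻ : ∀ {α β} → χ J? α · χ J? β ≡ 𝟙 → α ∈ J × β ∈ J
  χ·χ≡𝟙⁻ {α} {β} eq with J? α | J? β
  ... | yes α∈J | yes β∈J = α∈J , β∈J

  -- From exchange to the Plücker relations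

  MConvex⇒PlückerRelations : ∀ r (J≠∅ : Satisfiable J) → MConvex J → PlückerRelations r J? J≠∅
  MConvex⇒PlückerRelations r J≠∅ mc s _ _ α _ _ i j _ c≡1
    with count≡1⇒∃! (_≟ 𝟙) _ c≡1
  ... | k , eq , unique = contradiction (unique (proj₁ other) (proj₂ (proj₂ other))) (proj₁ (proj₂ other))
    where
    term : Fin (suc s) → 𝕂
    term l = χ J? (α ⊕ ε-sum (removeAt i l)) · χ J? (α ⊕ ε (lookup i l) ⊕ ε-sum j)
    β γ : Vec ℕ n
    β = α ⊕ ε-sum (removeAt i k)
    γ = α ⊕ ε (lookup i k) ⊕ ε-sum j
    β∈J : β ∈ J
    β∈J = proj₁ (χ·χ≡𝟙⁻ eq)
    γ∈J : γ ∈ J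
    γ∈J = proj₂ (χ·χ≡𝟙⁻ eq)

    α+ε≤γ : ∀ q → lookup α q + lookup (ε (lookup i k)) q ≤ lookup γ q
    α+ε≤γ q rewrite lookup-⊕ q (α ⊕ ε (lookup i k)) (ε-sum j) | lookup-⊕ q α (ε (lookup i k)) =
      m≤m+n _ _

    -- The surplus of `β` over `α` is the sum of the ε_{i_l} with l ≠ k; `punchIn k` turns a
    -- position in `removeAt i k` into one in `i`.
    α<β⇒∃l≢k : ∀ q → lookup α q < lookup β q → ∃[ l ] (l ≢ k × lookup i l ≡ q)
    α<β⇒∃l≢k q α<β with 0<lookup-ε-sum⇒∃ (removeAt i k) q
      (+-cancelˡ-< (lookup α q) _ _ (subst₂ _<_ (sym (+-identityʳ _)) (lookup-⊕ q α _) α<β))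
    ... | l , eq′ = punchIn k l , punchInᵢ≢i k l , trans (sym (lookup-removeAt i k l)) eq′

    term≡𝟙 : ∀ l → β ⊕ ε (lookup i k) ⊖ ε (lookup i l) ∈ J →
      γ ⊖ ε (lookup i k) ⊕ ε (lookup i l) ∈ J → term l ≡ 𝟙
    term≡𝟙 l β′∈J γ′∈J = χ·χ≡𝟙⁺ (subst J (exchangeˡ α i k l) β′∈J)
      (subst J (exchangeʳ α (ε (lookup i k)) (ε (lookup i l)) (ε-sum j)) γ′∈J)

    other : ∃[ l ] (l ≢ k × term l ≡ 𝟙)
    other with lookup β (lookup i k) <? lookup γ (lookup i k)
    ... | yes β<γ with mc β∈J γ∈J (lookup i k) β<γ
    ...   | q , γ<β , β′∈J , γ′∈J
      -- The index q returned by the exchange satisfies α_q ≤ γ_q < β_q, so it is some i_l with l ≠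
      -- k.
      with α<β⇒∃l≢k q (≤-<-trans (m+n≤o⇒m≤o (lookup α q) (α+ε≤γ q)) γ<β)
    ...   | l , l≢k , refl = l , l≢k , term≡𝟙 l β′∈J γ′∈J
    -- Here β ≥ γ ≥ α + 1 at i_k, so i_k occurs again in `i`, and exchanging it for itself fixes
    -- both `β` and `γ`.
    other | no β≮γ
      with α<β⇒∃l≢k (lookup i k)
        (≤-trans (m<m+n _ (0<lookup-ε (lookup i k))) (≤-trans (α+ε≤γ (lookup i k)) (≮⇒≥ β≮γ)))
    ...   | l , l≢k , iₗ≡iₖ = l , l≢k , term≡𝟙 l
      (subst (λ q → β ⊕ ε (lookup i k) ⊖ ε q ∈ J) (sym iₗ≡iₖ) (subst J (sym (x⊕y⊖y≡x β _)) β∈J))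
      (subst (λ q → γ ⊖ ε (lookup i k) ⊕ ε q ∈ J) (sym iₗ≡iₖ)
        (subst J (sym (exchangeʳ α (ε (lookup i k)) (ε (lookup i k)) (ε-sum j))) γ∈J))

  -- From the Plücker relations to exchange

  PlückerRelations⇒MConvex : ∀ r → J ⊆ Δ n r → (J≠∅ : Satisfiable J) →
    PlückerRelations r J? J≠∅ → MConvex J
  PlückerRelations⇒MConvex r J⊆Δ J≠∅ plücker {α} {β} α∈J β∈J i αᵢ<βᵢ
    with 0<lookup⇒≡ε⊕ i {β ⊖ α} (subst (0 <_) (sym (lookup-zipWith _∸_ i β α)) (m<n⇒0<n∸m αᵢ<βᵢ))
  ... | w , β⊖α≡ε⊕w with ε-sum-surjective (α ⊖ β) | ε-sum-surjective w
  ... | is , Σis≡α⊖β | js , Σjs≡w = exchange (sum w) (sum (α ⊖ β)) sum-α⊖β is js refl Σis≡α⊖β Σjs≡w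
    where
    μ : Vec ℕ n
    μ = α ∧ β

    α≡ : μ ⊕ (α ⊖ β) ≡ α
    α≡ = trans (cong (_⊕ (α ⊖ β)) (∧-comm α β)) (x∧y⊕[y⊖x]≡y β α)

    β≡ : μ ⊕ ε i ⊕ w ≡ β
    β≡ = trans (⊕-assoc μ (ε i) w) (trans (cong (μ ⊕_) (sym β⊖α≡ε⊕w)) (x∧y⊕[y⊖x]≡y α β))

    sum-μ : sum μ + sum (α ⊖ β) ≡ r
    sum-μ = trans (sym (sum-⊕ μ (α ⊖ β))) (trans (cong sum α≡) (J⊆Δ α∈J))

    -- Since `α` and `β` have the same degree, so do their excesses over `μ`, and that of `β` is ε_i
    -- + `w`. This fits the lengths of `is` and `js` to the relation with s = `sum (α ⊖ β)`.
    sum-α⊖β : sum (α ⊖ β) ≡ suc (sum w)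
    sum-α⊖β = +-cancelˡ-≡ (sum μ) _ _ (begin
      sum μ + sum (α ⊖ β)        ≡⟨ sum-μ ⟩
      r                          ≡⟨ J⊆Δ β∈J ⟨
      sum β                      ≡⟨ cong sum (trans (sym (⊕-assoc μ (ε i) w)) β≡) ⟨
      sum (μ ⊕ (ε i ⊕ w))        ≡⟨ sum-⊕ μ (ε i ⊕ w) ⟩
      sum μ + sum (ε i ⊕ w)      ≡⟨ cong (sum μ +_) (trans (sum-⊕ (ε i) w) (cong (_+ sum w) (sum-ε i))) ⟩
      sum μ + suc (sum w)        ∎)
      where open ≡-Reasoning

    lower : δ⁻ r J? J≠∅ ≤ᵛ μ
    lower = extensional⇒inductive (ext λ q → subst (_ ≤_) (sym (lookup-zipWith _⊓_ q α β))
      (⊓-glb (δ⁻-lower J? J≠∅ J⊆Δ q α∈J) (δ⁻-lower J? J≠∅ J⊆Δ q β∈J)))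

    upper : α ⊕ (β ⊖ α) ≤ᵛ δ⁺ r J? J≠∅
    upper = extensional⇒inductive (ext λ q → subst (_≤ _)
      (sym (trans (lookup-⊕ q α (β ⊖ α)) (cong (lookup α q +_) (lookup-zipWith _∸_ q β α))))
      (m≤o∧n≤o⇒m+[n∸m]≤o (δ⁺-upper J? J≠∅ J⊆Δ q α∈J) (δ⁺-upper J? J≠∅ J⊆Δ q β∈J)))

    Exchange : Set _
    Exchange = ∃[ q ] (lookup β q < lookup α q × (α ⊕ ε i ⊖ ε q) ∈ J × (β ⊖ ε i ⊕ ε q) ∈ J)

    -- With s = `suc t`, the position `suc l` in `i ∷ is` singles out a nonzero summand other than
    -- the 0-th.
    ∃term : ∀ t (is : Vec (Fin n) (suc t)) (js : Vec (Fin n) t) → suc t ≡ sum (α ⊖ β) →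
      μ ⊕ ε-sum is ∈ J → μ ⊕ ε i ⊕ ε-sum js ∈ J →
      μ ⊕ ε-sum (i ∷ is) ⊕ ε-sum js ≤ᵛ δ⁺ r J? J≠∅ →
      ∃[ l ] χ J? (μ ⊕ ε-sum (removeAt (i ∷ is) (suc l)))
             · χ J? (μ ⊕ ε (lookup is l) ⊕ ε-sum js) ≡ 𝟙
    -- For s = 1, α = μ + ε_p and β = μ + ε_i, so the summand at p has the factors of the 0-th one
    -- in reverse order.
    ∃term zero    (p ∷ []) [] _ α∈J β∈J _ = zero ,
      χ·χ≡𝟙⁺ (subst J (⊕-assoc μ (ε i) _) β∈J) (subst J (sym (⊕-assoc μ (ε p) _)) α∈J)
    ∃term (suc t) is js s≡ α∈J β∈J ≤δ⁺ = P0∧count≢1⇒∃ (_≟ 𝟙)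
      (λ l → χ J? (μ ⊕ ε-sum (removeAt (i ∷ is) l)) · χ J? (μ ⊕ ε (lookup (i ∷ is) l) ⊕ ε-sum js))
      (χ·χ≡𝟙⁺ α∈J β∈J)
      -- Both s ≤ r and the degree r - s of `μ` come from `sum-μ′`.
      (plücker (suc (suc t)) (s≤s (s≤s z≤n)) (subst (suc (suc t) ≤_) sum-μ′ (m≤n+m _ (sum μ)))
        μ (trans (sym (m+n∸n≡m (sum μ) (suc (suc t)))) (cong (_∸ suc (suc t)) sum-μ′))
        lower (i ∷ is) js ≤δ⁺)
      where
      sum-μ′ : sum μ + suc (suc t) ≡ r
      sum-μ′ = trans (cong (sum μ +_) s≡) sum-μ

    -- The lengths are variables so that sum-α⊖β can be matched against refl.
    exchange : ∀ t s → s ≡ suc t → (is : Vec (Fin n) s) (js : Vec (Fin n) t) →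
      s ≡ sum (α ⊖ β) → ε-sum is ≡ α ⊖ β → ε-sum js ≡ w → Exchange
    exchange t _ refl is js s≡ Σis≡ Σjs≡ with ∃term t is js s≡ α′∈J β′∈J upper′
      where
      α′∈J : μ ⊕ ε-sum is ∈ J
      α′∈J = subst J (trans (sym α≡) (cong (μ ⊕_) (sym Σis≡))) α∈J
      β′∈J : μ ⊕ ε i ⊕ ε-sum js ∈ J
      β′∈J = subst J (trans (sym β≡) (cong (μ ⊕ ε i ⊕_) (sym Σjs≡))) β∈J
      upper′ : μ ⊕ ε-sum (i ∷ is) ⊕ ε-sum js ≤ᵛ δ⁺ r J? J≠∅
      upper′ = subst (_≤ᵛ δ⁺ r J? J≠∅) (sym (begin
        μ ⊕ (ε i ⊕ ε-sum is) ⊕ ε-sum js  ≡⟨ cong₂ (λ x y → μ ⊕ (ε i ⊕ x) ⊕ y) Σis≡ Σjs≡ ⟩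
        μ ⊕ (ε i ⊕ (α ⊖ β)) ⊕ w          ≡⟨ cong (_⊕ w) (⊕.x∙yz≈xz∙y μ (ε i) (α ⊖ β)) ⟩
        μ ⊕ (α ⊖ β) ⊕ ε i ⊕ w            ≡⟨ ⊕-assoc _ (ε i) w ⟩
        μ ⊕ (α ⊖ β) ⊕ (ε i ⊕ w)          ≡⟨ cong₂ _⊕_ α≡ (sym β⊖α≡ε⊕w) ⟩
        α ⊕ (β ⊖ α)                      ∎)) upper
        where open ≡-Reasoning
    ... | l , eq with χ·χ≡𝟙⁻ eq
    ...   | x∈J , y∈J = lookup is l , βq<αq ,
      -- The nonzero summand is read backwards as an exchange: position `zero` carries `i`, position
      -- `suc l` carries `lookup is l`.
      subst (λ x → x ⊕ ε i ⊖ ε (lookup is l) ∈ J) (trans (cong (μ ⊕_) Σis≡) α≡)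
        (subst J (sym (exchangeˡ μ (i ∷ is) zero (suc l))) x∈J) ,
      subst (λ y → y ⊖ ε i ⊕ ε (lookup is l) ∈ J) (trans (cong (μ ⊕ ε i ⊕_) Σjs≡) β≡)
        (subst J (sym (exchangeʳ μ (ε i) (ε (lookup is l)) (ε-sum js))) y∈J)
      where
      βq<αq : lookup β (lookup is l) < lookup α (lookup is l)
      -- An index listed in `is` lies in the support of `α ⊖ β`, and a nonzero truncated difference
      -- means strict inequality.
      βq<αq = m∸n≢0⇒n<m (>⇒≢ (subst (0 <_)
        (trans (cong (λ x → lookup x (lookup is l)) Σis≡) (lookup-zipWith _∸_ (lookup is l) α β))
        (0<lookup-ε-sum is l)))

theoremA : {ℓ : Level} (n r : ℕ) → n ≥ 1 →
    (J : Pred (Vec ℕ n) ℓ) (J? : Decidable J) →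
    J ⊆ Δ n r → (J≠∅ : Satisfiable J) →
    MConvex J ⇔ PlückerRelations r J? J≠∅
theoremA n r _ J J? J⊆Δ J≠∅ =
  mk⇔ (MConvex⇒PlückerRelations J? r J≠∅) (PlückerRelations⇒MConvex J? r J⊆Δ J≠∅)
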